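{- The prefixes $12$ and $21$ may be exchanged. That is, for every $k\ge 2$, every ordering $\tau=\tau_3\ldots\tau_k$ of $\{3,\dots,k\}$, and every $n$, $\mathcal{I}_n(12\tau_3\ldots\tau_k)=\mathcal{I}_n(21\tau_3\ldots\tau_k)$.
   Context: A permutation $\pi=\pi_1\ldots\pi_n\in\mathcal{S}_n$ avoids $\sigma\in\mathcal{S}_k$ if there is no subsequence $\pi_{i_1}\ldots\pi_{i_k}$, $i_1<\cdots<i_k$, whose order-preserving relabelling by $1,\dots,k$ is $\sigma$. $\mathcal{I}_n(\sigma)$ denotes the number of involutions in $\mathcal{S}_n$ (permutations whose square is the identity) which avoid $\sigma$. Write $\sigma\sim_{\mathcal I}\sigma'$ if $\mathcal{I}_n(\sigma)=\mathcal{I}_n(\sigma')$ for every $n$. For $\alpha,\beta\in\mathcal{S}_j$, the prefixes $\alpha$ and $\beta$ may be exchanged if for every $k\ge j$ and every ordering $\tau=\tau_{j+1}\ldots\tau_k$ of $\{j+1,\dots,k\}$, $\alpha_1\ldots\alpha_j\tau_{j+1}\ldots\tau_k\sim_{\mathcal I}\beta_1\ldots\beta_j\tau_{j+1}\ldots\tau_k$. -}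

module Defs where

open import Data.Fin.Base using (Fin; zero; suc; punchIn; _<_; finToFun; funToFin)
open import Data.Fin.Permutation
  using (Permutation′; _⟨$⟩ʳ_; _≈_; _∘ₚ_; id; insert; remove; insert-remove; insert-punchIn)
open import Data.Fin.Properties
  using (_≟_; _<?_; all?; any?; finToFun-funToFin; +↔⊎; punchIn-injective)
open import Data.List.Base using (List; []; _∷_; length; filter; allFin; cartesianProductWith)
open import Data.List.Membership.Propositional.Properties using (∈-allFin)
open import Data.List.Relation.Unary.All using ([])
open import Data.List.Relation.Unary.AllPairs using ([]; _∷_)
open import Data.List.Relation.Unary.Any using (here)
open import Data.List.Relation.Unary.Unique.Propositional.Properties using (allFin⁺)
import Data.List.Membership.Setoid as Membership
import Data.List.Membership.Setoid.Properties as Membershipₚ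
import Data.List.Relation.Unary.Unique.Setoid as Unique
import Data.List.Relation.Unary.Unique.Setoid.Properties as Uniqueₚ
open import Data.Nat.Base using (ℕ; zero; suc; _+_)
open import Data.Product.Base using (Σ-syntax; _×_; _,_)
open import Data.Sum.Function.Propositional using (_⊎-↔_)
open import Function.Bundles using (_⇔_; mk⇔; Equivalence)
open import Function.Construct.Composition using (_↔-∘_)
open import Function.Construct.Symmetry using (↔-sym)
open import Level using (0ℓ)
open import Relation.Binary.Bundles using (Setoid)
open import Relation.Binary.Definitions using (Monotonic₁)
open import Relation.Binary.PropositionalEquality
  using (_≡_; refl; sym; trans; cong; subst₂; setoid)
open import Relation.Nullary using (Dec; ¬_; ¬?)
open import Relation.Nullary.Decidable using (map′; _×-dec_; _→-dec_)
open import Relation.Unary using (Decidable)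

private
  variable
    j k n : ℕ

-- A permutation π is read in one-line notation as the word whose i-th letter
-- is π ⟨$⟩ʳ i; positions and values are numbered from 0.

IsInvolution : Permutation′ n → Set
IsInvolution π = π ∘ₚ π ≈ id

-- The letters of π in positions e 0 < e 1 < … relabel to σ.
IsOccurrence : Permutation′ k → Permutation′ n → (Fin k → Fin n) → Set
IsOccurrence σ π e =
  Monotonic₁ _<_ _<_ e ×
  (∀ a b → (π ⟨$⟩ʳ e a) < (π ⟨$⟩ʳ e b) ⇔ (σ ⟨$⟩ʳ a) < (σ ⟨$⟩ʳ b))

Contains : Permutation′ n → Permutation′ k → Set
Contains {n} {k} π σ = Σ[ e ∈ (Fin k → Fin n) ] IsOccurrence σ π e

Avoids : Permutation′ n → Permutation′ k → Set
Avoids π σ = ¬ Contains π σ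

involution? : Decidable (IsInvolution {n})
involution? π = all? λ i → (π ⟨$⟩ʳ (π ⟨$⟩ʳ i)) ≟ i

occurrence? : (σ : Permutation′ k) (π : Permutation′ n) → Decidable (IsOccurrence σ π)
occurrence? σ π e =
  map′ (λ m {a} {b} → m a b) (λ m a b → m {a} {b})
    (all? λ a → all? λ b → (a <? b) →-dec (e a <? e b))
  ×-dec
  (all? λ a → all? λ b →
    map′ (λ (f , g) → mk⇔ f g) (λ h → Equivalence.to h , Equivalence.from h)
      (((π ⟨$⟩ʳ e a) <? (π ⟨$⟩ʳ e b) →-dec (σ ⟨$⟩ʳ a) <? (σ ⟨$⟩ʳ b))
       ×-dec
       ((σ ⟨$⟩ʳ a) <? (σ ⟨$⟩ʳ b) →-dec (π ⟨$⟩ʳ e a) <? (π ⟨$⟩ʳ e b))))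

IsOccurrence-resp : (σ : Permutation′ k) (π : Permutation′ n) {e e′ : Fin k → Fin n} →
                    (∀ a → e a ≡ e′ a) → IsOccurrence σ π e → IsOccurrence σ π e′
IsOccurrence-resp σ π eq (mono , iso) =
  (λ {a} {b} a<b → subst₂ _<_ (eq a) (eq b) (mono a<b)) ,
  (λ a b → subst₂ (λ x y → (π ⟨$⟩ʳ x) < (π ⟨$⟩ʳ y) ⇔ (σ ⟨$⟩ʳ a) < (σ ⟨$⟩ʳ b))
                  (eq a) (eq b) (iso a b))

contains? : (π : Permutation′ n) (σ : Permutation′ k) → Dec (Contains π σ)
contains? π σ =
  map′ (λ (c , o) → finToFun c , o)
       (λ (e , o) → funToFin e ,
                    IsOccurrence-resp σ π (λ a → sym (finToFun-funToFin e a)) o)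
       (any? λ c → occurrence? σ π (finToFun c))

avoids? : (π : Permutation′ n) (σ : Permutation′ k) → Dec (Avoids π σ)
avoids? π σ = ¬? (contains? π σ)

permutations : (n : ℕ) → List (Permutation′ n)
permutations zero    = id ∷ []
permutations (suc n) = cartesianProductWith (insert zero) (allFin (suc n)) (permutations n)

ℐ : (n : ℕ) → Permutation′ k → ℕ
ℐ n σ = length (filter (λ π → involution? π ×-dec avoids? π σ) (permutations n))

infix 4 _∼_

_∼_ : Permutation′ j → Permutation′ k → Set
σ ∼ σ′ = ∀ n → ℐ n σ ≡ ℐ n σ′

-- The word α₁…αⱼ followed by the letters of τ, each raised by j. With k = j + m,
-- these are exactly the words α₁…αⱼ τⱼ₊₁…τₖ with τⱼ₊₁…τₖ an ordering of {j+1,…,k}.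
infixr 6 _⊕_

_⊕_ : Permutation′ j → Permutation′ k → Permutation′ (j + k)
α ⊕ τ = ↔-sym +↔⊎ ↔-∘ ((α ⊎-↔ τ) ↔-∘ +↔⊎)

Exchangeable : Permutation′ j → Permutation′ j → Set
Exchangeable α β = ∀ m (τ : Permutation′ m) → α ⊕ τ ∼ β ⊕ τ

-- ℐ is a genuine cardinality: permutations n lists every permutation of Fin n
-- exactly once, permutations being identified when they agree pointwise.

permutationSetoid : ℕ → Setoid 0ℓ 0ℓ
permutationSetoid n = record
  { Carrier       = Permutation′ n
  ; _≈_           = _≈_
  ; isEquivalence = record
    { refl  = λ _ → refl
    ; sym   = λ p i → sym (p i)
    ; trans = λ p q i → trans (p i) (q i)
    }
  }

insert-cong : ∀ {i i′} {π ρ : Permutation′ n} → i ≡ i′ → π ≈ ρ →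
              insert zero i π ≈ insert zero i′ ρ
insert-cong             refl _   zero        = refl
insert-cong {π = π} {ρ} refl π≈ρ (suc x) =
  trans (insert-punchIn zero _ π x)
    (trans (cong (punchIn _) (π≈ρ x)) (sym (insert-punchIn zero _ ρ x)))

insert-injective : ∀ {i i′} {π ρ : Permutation′ n} →
                   insert zero i π ≈ insert zero i′ ρ → i ≡ i′ × π ≈ ρ
insert-injective {i = i} {i′} {π} {ρ} eq with refl ← eq zero =
  refl , λ x → punchIn-injective i _ _
    (trans (sym (insert-punchIn zero i π x)) (trans (eq (suc x)) (insert-punchIn zero i ρ x)))

permutations-complete : ∀ n (π : Permutation′ n) → let open Membership (permutationSetoid n) in
                        π ∈ permutations n
permutations-complete zero    π = here λ ()
permutations-complete (suc n) π =
  Membershipₚ.∈-resp-≈ (permutationSetoid (suc n))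
    {x = insert zero (π ⟨$⟩ʳ zero) (remove zero π)} {y = π} (insert-remove zero π)
    (Membershipₚ.∈-cartesianProductWith⁺ (setoid _) (permutationSetoid n) (permutationSetoid (suc n))
      (λ {_} {_} {π} {ρ} → insert-cong {π = π} {ρ})
      (∈-allFin (π ⟨$⟩ʳ zero)) (permutations-complete n (remove zero π)))

permutations-unique : ∀ n → Unique.Unique (permutationSetoid n) (permutations n)
permutations-unique zero    = [] ∷ []
permutations-unique (suc n) =
  Uniqueₚ.cartesianProductWith⁺ (setoid _) (permutationSetoid n) (permutationSetoid (suc n))
    (insert zero) (λ {_} {_} {π} {ρ} → insert-injective {π = π} {ρ})
    (allFin⁺ (suc n)) (permutations-unique n)

{-# OPTIONS --safe #-}
module Submission where

-- Draw π as the cells (i, π i), and let D be the region of cells having an occurrence of τ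
-- or τ⁻¹ strictly above and to the right. D is a Ferrers shape, symmetric when π is an
-- involution, and an involution avoids 12τ (or 21τ) iff no occurrence of 12 (or 21) has its
-- bounding box inside D. Rearranging the entries of π inside D does not change D: a
-- maximal cell of D owes its membership to entries outside D. Among these
-- rearrangements exactly one avoids 12 inside D (sort columns from the right; two solutions
-- would conflict in the last column where they differ), and exactly one avoids 21. The
-- inverse of such a rearrangement is another one, since D and π are symmetric, so
-- by uniqueness it is an involution. Trading one for the other is the required bijection.

open import Defs
open import Data.Empty using (⊥; ⊥-elim)
open import Data.Fin.Base
  using (Fin; zero; suc; toℕ; fromℕ; _↑ˡ_; _↑ʳ_; splitAt; join; finToFun; funToFin; _<_; _>_)
open import Data.Fin.Induction using (<-wellFounded; >-wellFounded; >-weakInduction)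
open import Data.Fin.Patterns using (0F; 1F)
open import Data.Fin.Permutation
  using (Permutation′; _⟨$⟩ʳ_; _⟨$⟩ˡ_; _≈_; _∘ₚ_; id; flip; transpose; inverseˡ; inverseʳ)
open import Data.Fin.Properties
  using (_≟_; _<?_; all?; any?; <-cmp; toℕ<n; toℕ-fromℕ; toℕ-inject₁; toℕ-injective; toℕ-↑ˡ; toℕ-↑ʳ;
         splitAt-↑ˡ; splitAt-↑ʳ; join-splitAt; finToFun-funToFin; injective⇒≤)
open import Data.List.Base using (List; length; lookup; filter)
import Data.List.Membership.Propositional.Properties as ∈ₚ
import Data.List.Membership.Setoid as Membership
import Data.List.Membership.Setoid.Properties as Membershipₚ
open import Data.List.Relation.Unary.All as All using (All)
open import Data.List.Relation.Unary.All.Properties using (all-filter)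
open import Data.List.Relation.Unary.AllPairs using (_∷_)
import Data.List.Relation.Unary.Any as Any
import Data.List.Relation.Unary.Unique.Setoid as Unique
import Data.List.Relation.Unary.Unique.Setoid.Properties as Uniqueₚ
open import Data.Nat.Base as ℕ using (ℕ; _+_)
import Data.Nat.Properties as ℕ
open import Data.Product.Base using (∃-syntax; Σ-syntax; _×_; _,_; proj₁; proj₂)
open import Data.Sum.Base using (_⊎_; inj₁; inj₂; [_,_]′; swap)
import Data.Sum.Base as Sum
open import Function.Base using (_∘_)
open import Function.Bundles using (_⇔_; mk⇔; Equivalence)
open import Function.Construct.Composition using (_⇔-∘_)
open import Function.Construct.Symmetry using (⇔-sym)
open import Induction.WellFounded using (Acc; acc; WellFounded)
open import Level using (0ℓ; Level)
open import Relation.Binary.Bundles using (Setoid)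
open import Relation.Binary.Consequences using (tri⇒dec<)
import Relation.Binary.Construct.Flip.EqAndOrd as Flip
open import Relation.Binary.Core using (Rel)
open import Relation.Binary.Definitions
  using (Monotonic₁; Trichotomous; tri<; tri≈; tri>) renaming (Decidable to Decidable₂)
open import Relation.Binary.PropositionalEquality
  using (_≡_; _≢_; refl; sym; trans; cong; subst; subst₂)
open import Relation.Nullary using (Dec; ¬_; yes; no; contradiction)
open import Relation.Nullary.Decidable using (map′; _×-dec_; _⊎-dec_)

private
  variable
    j k m n : ℕ

open Equivalence using (to; from)

-- Permutations that agree outside a region of cells.

Cells : ℕ → Set₁
Cells n = Rel (Fin n) 0ℓ

-- Asking for both the old and the new cell of a changed column to lie in `D` makes this an
-- equivalence relation for every region `D`.
AgreeOff : Cells n → Permutation′ n → Permutation′ n → Set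
AgreeOff D π ρ = ∀ i → (π ⟨$⟩ʳ i) ≡ (ρ ⟨$⟩ʳ i) ⊎ D i (π ⟨$⟩ʳ i) × D i (ρ ⟨$⟩ʳ i)

AgreeOff-sym : {D : Cells n} (π ρ : Permutation′ n) → AgreeOff D π ρ → AgreeOff D ρ π
AgreeOff-sym π ρ π~ρ i with π~ρ i
... | inj₁ eq        = inj₁ (sym eq)
... | inj₂ (dπ , dρ) = inj₂ (dρ , dπ)

AgreeOff-trans : {D : Cells n} (π ρ χ : Permutation′ n) → AgreeOff D π ρ → AgreeOff D ρ χ → AgreeOff D π χ
AgreeOff-trans {D = D} π ρ χ π~ρ ρ~χ i with π~ρ i | ρ~χ i
... | inj₁ eq        | inj₁ eq′       = inj₁ (trans eq eq′)
... | inj₁ eq        | inj₂ (dρ , dχ) = inj₂ (subst (D i) (sym eq) dρ , dχ)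
... | inj₂ (dπ , dρ) | inj₁ eq        = inj₂ (dπ , subst (D i) eq dρ)
... | inj₂ (dπ , _)  | inj₂ (_ , dχ)  = inj₂ (dπ , dχ)

AgreeOff-mono : {D E : Cells n} → (∀ {i x} → D i x → E i x) → (π ρ : Permutation′ n) →
                AgreeOff D π ρ → AgreeOff E π ρ
AgreeOff-mono D⊆E π ρ π~ρ i = Sum.map₂ (λ (dπ , dρ) → D⊆E dπ , D⊆E dρ) (π~ρ i)

-- For a value `x`, look at the columns where `π` and `ρ` take it. If either column is unchanged,
-- the two columns coincide. Otherwise both are changed inside `D`, which places both cells at
-- height `x` in `D`.
AgreeOff-flip : {D : Cells n} (π ρ : Permutation′ n) → AgreeOff D π ρ →
                AgreeOff (λ x i → D i x) (flip π) (flip ρ)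
AgreeOff-flip {D = D} π ρ π~ρ x with π~ρ (π ⟨$⟩ˡ x) | π~ρ (ρ ⟨$⟩ˡ x)
... | inj₁ eq | _       = inj₁ (trans (sym (inverseˡ ρ)) (cong (ρ ⟨$⟩ˡ_) (trans (sym eq) (inverseʳ π))))
... | _       | inj₁ eq = inj₁ (trans (cong (π ⟨$⟩ˡ_) (trans (sym (inverseʳ ρ)) (sym eq))) (inverseˡ π))
... | inj₂ (dπ , _) | inj₂ (_ , dρ) = inj₂ (subst (D _) (inverseʳ π) dπ , subst (D _) (inverseʳ ρ) dρ)

-- Uniqueness and existence of the sorted rearrangement.

-- Inside D, no entry to the left of column c is ⊏-below the entry of column c.
-- For a down-set D only the higher of the two cells in column c matters.
CleanColumn : Rel (Fin n) 0ℓ → Cells n → Permutation′ n → Fin n → Set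
CleanColumn _⊏_ D π c = ∀ i → i < c → (π ⟨$⟩ʳ i) ⊏ (π ⟨$⟩ʳ c) → D c (π ⟨$⟩ʳ i) → D c (π ⟨$⟩ʳ c) → ⊥

-- Where two permutations last differ, one of them has an unclean column.
clean-unique : {_⊏_ : Rel (Fin n) 0ℓ} → Trichotomous _≡_ _⊏_ → {D : Cells n} (π ρ : Permutation′ n) →
               AgreeOff D π ρ → (∀ c → CleanColumn _⊏_ D π c) → (∀ c → CleanColumn _⊏_ D ρ c) → π ≈ ρ
clean-unique {_⊏_ = _⊏_} cmp {D} π ρ π~ρ π-clean ρ-clean c = agree c (>-wellFounded c)
  where
  -- `ρ` must take the value of `π` at `c` somewhere: not at `c`, and not to the right, where the
  -- two coincide. So it takes it to the left, and this entry offends against column `c`.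
  unclean : (π ρ : Permutation′ _) → ∀ c → (∀ {i} → c < i → (π ⟨$⟩ʳ i) ≡ (ρ ⟨$⟩ʳ i)) →
            (π ⟨$⟩ʳ c) ≢ (ρ ⟨$⟩ʳ c) → (π ⟨$⟩ʳ c) ⊏ (ρ ⟨$⟩ʳ c) →
            D c (π ⟨$⟩ʳ c) → D c (ρ ⟨$⟩ʳ c) → ¬ CleanColumn _⊏_ D ρ c
  unclean π ρ c later c≢ c⊏ dπ dρ clean =
    clean i i<c (subst (_⊏ _) (sym ρi≡) c⊏) (subst (D c) (sym ρi≡) dπ) dρ
    where
    i = ρ ⟨$⟩ˡ (π ⟨$⟩ʳ c)
    ρi≡ : (ρ ⟨$⟩ʳ i) ≡ (π ⟨$⟩ʳ c)
    ρi≡ = inverseʳ ρ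
    i≢c : i ≢ c
    i≢c i≡c = c≢ (trans (sym ρi≡) (cong (ρ ⟨$⟩ʳ_) i≡c))
    i<c : i < c
    i<c with <-cmp i c
    ... | tri< i<c _ _ = i<c
    ... | tri≈ _ i≡c _ = contradiction i≡c i≢c
    ... | tri> _ _ c<i = contradiction
      (trans (sym (inverseˡ π)) (trans (cong (π ⟨$⟩ˡ_) (trans (later c<i) ρi≡)) (inverseˡ π))) i≢c

  agree : ∀ c → Acc _>_ c → (π ⟨$⟩ʳ c) ≡ (ρ ⟨$⟩ʳ c)
  agree c (acc rec) with π~ρ c | cmp (π ⟨$⟩ʳ c) (ρ ⟨$⟩ʳ c)
  ... | inj₁ eq        | _             = eq
  ... | _              | tri≈ _ eq _   = eq
  ... | inj₂ (dπ , dρ) | tri< c⊏ c≢ _ =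
    ⊥-elim (unclean π ρ c (λ c<i → agree _ (rec c<i)) c≢ c⊏ dπ dρ (ρ-clean c))
  ... | inj₂ (dπ , dρ) | tri> _ c≢ c⊐ =
    ⊥-elim (unclean ρ π c (λ c<i → sym (agree _ (rec c<i))) (c≢ ∘ sym) c⊐ dρ dπ (π-clean c))

-- Indexing by the result lets a match replace the transposed position by its value in each case.
data TransposeView (i j : Fin n) (k : Fin n) : Fin n → Set where
  first  : k ≡ i → TransposeView i j k j
  second : k ≡ j → TransposeView i j k i
  other  : k ≢ i → k ≢ j → TransposeView i j k k

transposeView : (i j k : Fin n) → TransposeView i j k (transpose i j ⟨$⟩ʳ k)
transposeView i j k with k ≟ i
... | yes k≡i = first k≡i
... | no  k≢i with k ≟ j
...   | yes k≡j = second k≡j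
...   | no  k≢j = other k≢i k≢j

-- Columns are cleaned from right to left. Each swap exchanges column `c` with an earlier one, so
-- later columns stay clean, and `D-left` keeps both moved entries inside `D`.
clean-exists : {_⊏_ : Rel (Fin n) 0ℓ} → Decidable₂ _⊏_ → WellFounded _⊏_ →
               {D : Cells n} → Decidable₂ D → (∀ {i c x} → i < c → D c x → D i x) →
               (π : Permutation′ n) → ∃[ ρ ] AgreeOff D π ρ × (∀ c → CleanColumn _⊏_ D ρ c)
clean-exists {n = n} {_⊏_ = _⊏_} ⊏? wf {D} D? D-left π =
  let ρ , π~ρ , clean = columns zero in ρ , π~ρ , λ c → clean c ℕ.z≤n
  where
  -- The bound is a natural number so that the induction can start at `n`, past the last column,
  -- with nothing to clean.
  CleanFrom CleanAfter : ℕ → Permutation′ n → Set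
  CleanFrom  c ρ = ∀ c′ → c ℕ.≤ toℕ c′ → CleanColumn _⊏_ D ρ c′
  CleanAfter c ρ = ∀ c′ → c ℕ.< toℕ c′ → CleanColumn _⊏_ D ρ c′

  -- Exchanging an offending pair makes the entry of column c smaller.
  cleanColumn : ∀ c ρ → Acc _⊏_ (ρ ⟨$⟩ʳ c) → AgreeOff D π ρ → CleanAfter (toℕ c) ρ →
                ∃[ ρ′ ] AgreeOff D π ρ′ × CleanFrom (toℕ c) ρ′
  cleanColumn c ρ (acc rec) π~ρ after
    with any? (λ i → (i <? c) ×-dec ⊏? (ρ ⟨$⟩ʳ i) (ρ ⟨$⟩ʳ c) ×-dec
                     D? c (ρ ⟨$⟩ʳ i) ×-dec D? c (ρ ⟨$⟩ʳ c))
  ... | no  none = ρ , π~ρ , from-c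
    where
    from-c : CleanFrom (toℕ c) ρ
    from-c c′ c≤c′ with ℕ.m≤n⇒m<n∨m≡n c≤c′
    ... | inj₁ c<c′ = after c′ c<c′
    ... | inj₂ c≡c′ rewrite sym (toℕ-injective c≡c′) = λ i i<c i⊏c di dc → none (i , i<c , i⊏c , di , dc)
  ... | yes (i , i<c , i⊏c , di , dc) =
    cleanColumn c ρ′ (rec (subst (_⊏ (ρ ⟨$⟩ʳ c)) (sym ρ′c≡) i⊏c)) (AgreeOff-trans {D = D} π ρ ρ′ π~ρ ρ~ρ′) after′
    where
    t = transpose i c
    ρ′ = t ∘ₚ ρ

    tc≡i : (t ⟨$⟩ʳ c) ≡ i
    tc≡i with (t ⟨$⟩ʳ c) | transposeView i c c
    ... | _ | first c≡i   = c≡i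
    ... | _ | second _    = refl
    ... | _ | other _ c≢c = contradiction refl c≢c

    ρ′c≡ : (ρ′ ⟨$⟩ʳ c) ≡ (ρ ⟨$⟩ʳ i)
    ρ′c≡ = cong (ρ ⟨$⟩ʳ_) tc≡i

    ρ~ρ′ : AgreeOff D ρ ρ′
    ρ~ρ′ k with (t ⟨$⟩ʳ k) | transposeView i c k
    ... | _ | first refl  = inj₂ (D-left i<c di , D-left i<c dc)
    ... | _ | second refl = inj₂ (dc , di)
    ... | _ | other _ _   = inj₁ refl

    after′ : CleanAfter (toℕ c) ρ′
    after′ c′ c<c′ k k<c′ with (t ⟨$⟩ʳ c′) | transposeView i c c′
    ... | _ | first refl  = contradiction i<c (ℕ.<-asym c<c′)
    ... | _ | second refl = contradiction c<c′ (ℕ.<-irrefl refl)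
    -- Both swapped columns lie left of `c′`, so the entries left of `c′` are merely permuted.
    ... | _ | other _ _   = after c′ c<c′ (t ⟨$⟩ʳ k) tk<c′
      where
      tk<c′ : (t ⟨$⟩ʳ k) < c′
      tk<c′ with (t ⟨$⟩ʳ k) | transposeView i c k
      ... | _ | first _   = c<c′
      ... | _ | second _  = ℕ.<-trans i<c c<c′
      ... | _ | other _ _ = k<c′

  columns : ∀ (c : Fin (ℕ.suc n)) → ∃[ ρ ] AgreeOff D π ρ × CleanFrom (toℕ c) ρ
  columns = >-weakInduction _
    (π , (λ _ → inj₁ refl) , λ c n≤c → contradiction (toℕ<n c) (ℕ.≤⇒≯ (subst (ℕ._≤ toℕ c) (toℕ-fromℕ n) n≤c)))
    -- `CleanFrom` at the successor of `c` unfolds to `CleanAfter` at `c`.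
    λ c (ρ , π~ρ , after) →
      subst (λ c → ∃[ ρ ] AgreeOff D π ρ × CleanFrom c ρ) (sym (toℕ-inject₁ c))
        (cleanColumn c ρ (wf _) π~ρ after)

-- Occurrences under change of permutation and under inversion.

occurrence-reflects-< : (σ : Permutation′ k) (π : Permutation′ n) {e : Fin k → Fin n} → IsOccurrence σ π e →
                        ∀ {a b} → e a < e b → a < b
occurrence-reflects-< σ π (mono , _) {a} {b} ea<eb with <-cmp a b
... | tri< a<b _ _    = a<b
... | tri≈ _ refl _   = contradiction ea<eb (ℕ.<-irrefl refl)
... | tri> _ _ b<a    = contradiction (mono b<a) (ℕ.<-asym ea<eb)

-- Agreement is asked for only at the positions of the occurrence, so that an occurrence outside a
-- region survives rearrangement inside it.
occurrence-cong : (σ ς : Permutation′ k) → σ ≈ ς → (π ρ : Permutation′ n) {e : Fin k → Fin n} →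
                  (∀ a → (π ⟨$⟩ʳ e a) ≡ (ρ ⟨$⟩ʳ e a)) → IsOccurrence σ π e → IsOccurrence ς ρ e
occurrence-cong σ ς σ≈ς π ρ eq (mono , iso) = mono , λ a b → mk⇔
  (λ lt → subst₂ _<_ (σ≈ς a) (σ≈ς b) (to (iso a b) (subst₂ _<_ (sym (eq a)) (sym (eq b)) lt)))
  (λ lt → subst₂ _<_ (eq a) (eq b) (from (iso a b) (subst₂ _<_ (sym (σ≈ς a)) (sym (σ≈ς b)) lt)))

-- Reflection in the diagonal lists the same cells by increasing value: the cell of rank `b` stands
-- at index `σ ⟨$⟩ˡ b`.
occurrence-flip : (σ : Permutation′ k) (π : Permutation′ n) {e : Fin k → Fin n} → IsOccurrence σ π e →
                  IsOccurrence (flip σ) (flip π) (λ b → π ⟨$⟩ʳ e (σ ⟨$⟩ˡ b))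
occurrence-flip σ π {e} occ@(mono , iso) =
  (λ {a} {b} a<b → from (iso _ _) (subst₂ _<_ (sym (inverseʳ σ)) (sym (inverseʳ σ)) a<b)) ,
  λ a b → mk⇔
    (λ lt → occurrence-reflects-< σ π occ (subst₂ _<_ (inverseˡ π) (inverseˡ π) lt))
    (λ lt → subst₂ _<_ (sym (inverseˡ π)) (sym (inverseˡ π)) (mono lt))

Contains-cong : (σ : Permutation′ k) (π ρ : Permutation′ n) → π ≈ ρ → Contains π σ → Contains ρ σ
Contains-cong σ π ρ π≈ρ (e , occ) = e , occurrence-cong σ σ (λ _ → refl) π ρ (λ a → π≈ρ (e a)) occ

-- The shape, its invariance under rearrangement and its symmetry.

Below : Permutation′ m → Permutation′ n → Cells n
Below {m} {n} σ π i x = Σ[ e ∈ (Fin m → Fin n) ] IsOccurrence σ π e × (∀ a → i < e a × x < (π ⟨$⟩ʳ e a))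

below? : (σ : Permutation′ m) (π : Permutation′ n) → Decidable₂ (Below σ π)
below? σ π i x = map′
  (λ (c , occ , ne) → finToFun c , occ , ne)
  (λ (e , occ , ne) → let eq = λ a → sym (finToFun-funToFin e a) in
     funToFin e , IsOccurrence-resp σ π eq occ ,
     λ a → subst (λ p → i < p × x < (π ⟨$⟩ʳ p)) (eq a) (ne a))
  (any? λ c → occurrence? σ π (finToFun c) ×-dec
              all? λ a → (i <? finToFun c a) ×-dec (x <? (π ⟨$⟩ʳ finToFun c a)))

Below-flip : (σ : Permutation′ m) (π : Permutation′ n) → ∀ {i x} → Below σ π i x → Below (flip σ) (flip π) x i
Below-flip σ π (e , occ , ne) = _ , occurrence-flip σ π occ ,
  λ b → proj₂ (ne _) , subst (_ <_) (sym (inverseˡ π)) (proj₁ (ne (σ ⟨$⟩ˡ b)))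

Below-cong : (σ : Permutation′ m) (π ρ : Permutation′ n) → π ≈ ρ → ∀ {i x} → Below σ π i x → Below σ ρ i x
Below-cong σ π ρ π≈ρ (e , occ , ne) =
  e , occurrence-cong σ σ (λ _ → refl) π ρ (λ a → π≈ρ (e a)) occ ,
  λ a → proj₁ (ne a) , subst (_ <_) (π≈ρ (e a)) (proj₂ (ne a))

-- Admitting τ⁻¹ as well as τ makes the region symmetric for an involution, which
-- contains α ⊕ τ iff it contains α⁻¹ ⊕ τ⁻¹.
Shape : Permutation′ m → Permutation′ n → Cells n
Shape τ π i x = ∃[ σ ] (σ ≡ τ ⊎ σ ≡ flip τ) × Below σ π i x

shape? : (τ : Permutation′ m) (π : Permutation′ n) → Decidable₂ (Shape τ π)
shape? τ π i x = map′
  [ (λ b → τ , inj₁ refl , b) , (λ b → flip τ , inj₂ refl , b) ]′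
  (λ { (_ , inj₁ refl , b) → inj₁ b ; (_ , inj₂ refl , b) → inj₂ b })
  (below? τ π i x ⊎-dec below? (flip τ) π i x)

Shape-down : (τ : Permutation′ m) (π : Permutation′ n) → ∀ {i c x y} → toℕ i ℕ.≤ toℕ c → toℕ x ℕ.≤ toℕ y →
             Shape τ π c y → Shape τ π i x
Shape-down τ π i≤c x≤y (σ , τ± , e , occ , ne) =
  σ , τ± , e , occ , λ a → ℕ.≤-<-trans i≤c (proj₁ (ne a)) , ℕ.≤-<-trans x≤y (proj₂ (ne a))

-- If some entry of the occurrence lies in the shape, pass to an occurrence witnessing that. It lies
-- strictly further to the right, so the process stops.
Shape-outside : (τ : Permutation′ m) (π : Permutation′ n) → ∀ {i x} → Acc _>_ i → Shape τ π i x →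
                ∃[ σ ] (σ ≡ τ ⊎ σ ≡ flip τ) × Σ[ e ∈ (Fin m → Fin n) ] IsOccurrence σ π e ×
                  (∀ a → (i < e a × x < (π ⟨$⟩ʳ e a)) × ¬ Shape τ π (e a) (π ⟨$⟩ʳ e a))
Shape-outside τ π (acc rec) (σ , τ± , e , occ , ne) with any? (λ a → shape? τ π (e a) (π ⟨$⟩ʳ e a))
... | no  none = σ , τ± , e , occ , λ a → ne a , λ s → none (a , s)
... | yes (a , s) =
  let σ′ , τ±′ , e′ , occ′ , out = Shape-outside τ π (rec (proj₁ (ne a))) s in
  σ′ , τ±′ , e′ , occ′ , λ b →
    let (ea<e′b , πea<) , off = out b in
    (ℕ.<-trans (proj₁ (ne a)) ea<e′b , ℕ.<-trans (proj₂ (ne a)) πea<) , off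

-- A witness whose entries avoid the shape is untouched by the rearrangement. Allowing any `D`
-- within the shape of `π` lets the lemma also be used from `ρ` back to `π`.
Shape-⊆ : (τ : Permutation′ m) (π ρ : Permutation′ n) {D : Cells n} → (∀ {i x} → D i x → Shape τ π i x) →
          AgreeOff D π ρ → ∀ {i x} → Shape τ π i x → Shape τ ρ i x
Shape-⊆ τ π ρ D⊆ π~ρ s =
  let σ , τ± , e , occ , out = Shape-outside τ π (>-wellFounded _) s
      agree : ∀ a → (π ⟨$⟩ʳ e a) ≡ (ρ ⟨$⟩ʳ e a)
      agree a = [ (λ eq → eq) , (λ (d , _) → contradiction (D⊆ d) (proj₂ (out a))) ]′ (π~ρ (e a))
  in σ , τ± , e , occurrence-cong σ σ (λ _ → refl) π ρ agree occ ,
     λ a → let (i<ea , x<) , _ = out a in i<ea , subst (_ <_) (agree a) x<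

Shape-⊇ : (τ : Permutation′ m) (π ρ : Permutation′ n) → AgreeOff (Shape τ π) π ρ →
          ∀ {i x} → Shape τ ρ i x → Shape τ π i x
Shape-⊇ τ π ρ π~ρ = Shape-⊆ τ ρ π (Shape-⊆ τ π ρ (λ s → s) π~ρ) (AgreeOff-sym {D = Shape τ π} π ρ π~ρ)

involution-flip : (π : Permutation′ n) → IsInvolution π → flip π ≈ π
involution-flip π inv i = trans (cong (π ⟨$⟩ˡ_) (sym (inv i))) (inverseˡ π)

Shape-sym : (τ : Permutation′ m) (π : Permutation′ n) → IsInvolution π → ∀ {i x} → Shape τ π i x → Shape τ π x i
Shape-sym τ π inv (σ , τ± , b) =
  -- Inverting twice is definitionally the identity, so inversion just exchanges the two
  -- alternatives `τ` and `flip τ`.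
  flip σ , swap (Sum.map (cong flip) (cong flip) τ±) ,
  Below-cong (flip σ) (flip π) π (involution-flip π inv) (Below-flip σ π b)

-- Patterns of length two inside a region.

-- The cell named here is the top right corner of the occurrence's bounding box.
ContainsWithin : Cells n → Permutation′ n → Permutation′ 2 → Set
ContainsWithin {n} D π α =
  Σ[ e ∈ (Fin 2 → Fin n) ] IsOccurrence α π e × D (e 1F) (π ⟨$⟩ʳ e (α ⟨$⟩ˡ 1F))

-- Reflection exchanges the coordinates of the box's top right corner, and a self-inverse `α` is
-- carried to itself.
ContainsWithin-flip : {D : Cells n} (π : Permutation′ n) (α : Permutation′ 2) → flip α ≈ α →
                      ContainsWithin D π α → ContainsWithin (λ x i → D i x) (flip π) α
ContainsWithin-flip {D = D} π α α⁻¹≈α (e , occ , d) =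
  _ , occurrence-cong (flip α) α α⁻¹≈α (flip π) (flip π) (λ _ → refl) (occurrence-flip α π occ) ,
  subst (λ i → D i (π ⟨$⟩ʳ e (α ⟨$⟩ˡ 1F))) (sym eq) d
  where
  eq : (π ⟨$⟩ˡ (π ⟨$⟩ʳ e (α ⟨$⟩ˡ (α ⟨$⟩ˡ 1F)))) ≡ e 1F
  eq = trans (inverseˡ π) (cong e (trans (cong (α ⟨$⟩ˡ_) (α⁻¹≈α 1F)) (inverseˡ α)))

≤1F : (a : Fin 2) → toℕ a ℕ.≤ 1
≤1F a = ℕ.s≤s⁻¹ (toℕ<n a)

occurrence-right : (α : Permutation′ 2) (π : Permutation′ n) {e : Fin 2 → Fin n} → IsOccurrence α π e →
                   ∀ a → toℕ (e a) ℕ.≤ toℕ (e 1F)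
occurrence-right α π occ a =
  ℕ.≮⇒≥ λ lt → ℕ.≤⇒≯ (≤1F a) (occurrence-reflects-< α π occ lt)

occurrence-top : (α : Permutation′ 2) (π : Permutation′ n) {e : Fin 2 → Fin n} → IsOccurrence α π e →
                 ∀ a → toℕ (π ⟨$⟩ʳ e a) ℕ.≤ toℕ (π ⟨$⟩ʳ e (α ⟨$⟩ˡ 1F))
occurrence-top α π (_ , iso) a =
  ℕ.≮⇒≥ λ lt → ℕ.≤⇒≯ (≤1F (α ⟨$⟩ʳ a)) (subst (_< (α ⟨$⟩ʳ a)) (inverseʳ α) (to (iso _ _) lt))

-- Occurrences of a direct sum.

⊕-↑ˡ : (α : Permutation′ j) (τ : Permutation′ m) → ∀ a → ((α ⊕ τ) ⟨$⟩ʳ (a ↑ˡ m)) ≡ (α ⟨$⟩ʳ a) ↑ˡ m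
⊕-↑ˡ {j} {m} α τ a rewrite splitAt-↑ˡ j a m = refl

⊕-↑ʳ : (α : Permutation′ j) (τ : Permutation′ m) → ∀ a → ((α ⊕ τ) ⟨$⟩ʳ (j ↑ʳ a)) ≡ j ↑ʳ (τ ⟨$⟩ʳ a)
⊕-↑ʳ {j} {m} α τ a rewrite splitAt-↑ʳ j m a = refl

↑ˡ-< : ∀ m {a b : Fin j} → a < b ⇔ (a ↑ˡ m) < (b ↑ˡ m)
↑ˡ-< m {a} {b} = mk⇔ (subst₂ ℕ._<_ (sym (toℕ-↑ˡ a m)) (sym (toℕ-↑ˡ b m)))
                     (subst₂ ℕ._<_ (toℕ-↑ˡ a m) (toℕ-↑ˡ b m))

↑ʳ-< : ∀ j {a b : Fin m} → a < b ⇔ (j ↑ʳ a) < (j ↑ʳ b)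
↑ʳ-< j {a} {b} = mk⇔
  (λ lt → subst₂ ℕ._<_ (sym (toℕ-↑ʳ j a)) (sym (toℕ-↑ʳ j b)) (ℕ.+-monoʳ-< j lt))
  (λ lt → ℕ.+-cancelˡ-< j _ _ (subst₂ ℕ._<_ (toℕ-↑ʳ j a) (toℕ-↑ʳ j b) lt))

↑ˡ<↑ʳ : (a : Fin j) (b : Fin m) → (a ↑ˡ m) < (j ↑ʳ b)
↑ˡ<↑ʳ {j} {m} a b = subst₂ ℕ._<_ (sym (toℕ-↑ˡ a m)) (sym (toℕ-↑ʳ j b)) (ℕ.<-≤-trans (toℕ<n a) (ℕ.m≤m+n j _))

data SplitView (j m : ℕ) : Fin (j + m) → Set where
  left  : (a : Fin j) → SplitView j m (a ↑ˡ m)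
  right : (b : Fin m) → SplitView j m (j ↑ʳ b)

splitView : ∀ j m c → SplitView j m c
splitView j m c = subst (SplitView j m) (join-splitAt j m c) (view (splitAt j c))
  where
  view : (s : Fin j ⊎ Fin m) → SplitView j m (join j m s)
  view (inj₁ a) = left a
  view (inj₂ b) = right b

⊕-occurrence⁺ : (α : Permutation′ j) (τ : Permutation′ m) (π : Permutation′ n)
                {e : Fin j → Fin n} {f : Fin m → Fin n} → IsOccurrence α π e → IsOccurrence τ π f →
                (∀ a b → e a < f b × (π ⟨$⟩ʳ e a) < (π ⟨$⟩ʳ f b)) →
                Contains π (α ⊕ τ)
⊕-occurrence⁺ {j} {m} {n} α τ π {e} {f} (e-mono , e-iso) (f-mono , f-iso) e<f =
  g , (λ {c} {d} → mono (splitView j m c) (splitView j m d)) , λ c d → iso (splitView j m c) (splitView j m d)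
  where
  g : Fin (j + m) → Fin n
  g c = [ e , f ]′ (splitAt j c)

  gˡ : ∀ a → g (a ↑ˡ m) ≡ e a
  gˡ a = cong [ e , f ]′ (splitAt-↑ˡ j a m)

  gʳ : ∀ b → g (j ↑ʳ b) ≡ f b
  gʳ b = cong [ e , f ]′ (splitAt-↑ʳ j m b)

  mono : ∀ {c d} → SplitView j m c → SplitView j m d → c < d → g c < g d
  mono (left a)  (left b)  lt = subst₂ _<_ (sym (gˡ a)) (sym (gˡ b)) (e-mono (from (↑ˡ-< m) lt))
  mono (left a)  (right b) lt = subst₂ _<_ (sym (gˡ a)) (sym (gʳ b)) (proj₁ (e<f a b))
  mono (right a) (left b)  lt = contradiction lt (ℕ.<-asym (↑ˡ<↑ʳ b a))
  mono (right a) (right b) lt = subst₂ _<_ (sym (gʳ a)) (sym (gʳ b)) (f-mono (from (↑ʳ-< j) lt))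

  iso : ∀ {c d} → SplitView j m c → SplitView j m d →
        (π ⟨$⟩ʳ g c) < (π ⟨$⟩ʳ g d) ⇔ ((α ⊕ τ) ⟨$⟩ʳ c) < ((α ⊕ τ) ⟨$⟩ʳ d)
  iso (left a)  (left b)  rewrite gˡ a | gˡ b | ⊕-↑ˡ α τ a | ⊕-↑ˡ α τ b = ↑ˡ-< m ⇔-∘ e-iso a b
  -- In the mixed cases both sides are decided in advance: the letter from `τ` is always the larger.
  iso (left a)  (right b) rewrite gˡ a | gʳ b | ⊕-↑ˡ α τ a | ⊕-↑ʳ α τ b =
    mk⇔ (λ _ → ↑ˡ<↑ʳ _ _) (λ _ → proj₂ (e<f a b))
  iso (right a) (left b)  rewrite gʳ a | gˡ b | ⊕-↑ʳ α τ a | ⊕-↑ˡ α τ b =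
    mk⇔ (λ lt → contradiction lt (ℕ.<-asym (proj₂ (e<f b a))))
        (λ lt → contradiction lt (ℕ.<-asym (↑ˡ<↑ʳ _ _)))
  iso (right a) (right b) rewrite gʳ a | gʳ b | ⊕-↑ʳ α τ a | ⊕-↑ʳ α τ b = ↑ʳ-< j ⇔-∘ f-iso a b

⊕-occurrence⁻ : (α : Permutation′ j) (τ : Permutation′ m) (π : Permutation′ n) {g : Fin (j + m) → Fin n} →
                IsOccurrence (α ⊕ τ) π g →
                IsOccurrence α π (λ a → g (a ↑ˡ m)) × IsOccurrence τ π (λ b → g (j ↑ʳ b)) ×
                (∀ a b → g (a ↑ˡ m) < g (j ↑ʳ b) × (π ⟨$⟩ʳ g (a ↑ˡ m)) < (π ⟨$⟩ʳ g (j ↑ʳ b)))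
⊕-occurrence⁻ {j} {m} α τ π {g} (mono , iso) =
  ((λ lt → mono (to (↑ˡ-< m) lt)) , isoˡ) ,
  ((λ lt → mono (to (↑ʳ-< j) lt)) , isoʳ) ,
  λ a b → mono (↑ˡ<↑ʳ a b) ,
          from (iso _ _) (subst₂ _<_ (sym (⊕-↑ˡ α τ a)) (sym (⊕-↑ʳ α τ b)) (↑ˡ<↑ʳ _ _))
  where
  isoˡ : ∀ a b → (π ⟨$⟩ʳ g (a ↑ˡ m)) < (π ⟨$⟩ʳ g (b ↑ˡ m)) ⇔ (α ⟨$⟩ʳ a) < (α ⟨$⟩ʳ b)
  isoˡ a b with iso (a ↑ˡ m) (b ↑ˡ m)
  ... | h rewrite ⊕-↑ˡ α τ a | ⊕-↑ˡ α τ b = ⇔-sym (↑ˡ-< m) ⇔-∘ h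

  isoʳ : ∀ a b → (π ⟨$⟩ʳ g (j ↑ʳ a)) < (π ⟨$⟩ʳ g (j ↑ʳ b)) ⇔ (τ ⟨$⟩ʳ a) < (τ ⟨$⟩ʳ b)
  isoʳ a b with iso (j ↑ʳ a) (j ↑ʳ b)
  ... | h rewrite ⊕-↑ʳ α τ a | ⊕-↑ʳ α τ b = ⇔-sym (↑ʳ-< j) ⇔-∘ h

-- The entries of `τ` lie above and to the right of both entries of `α` exactly when they lie so
-- relative to the corner of their bounding box.
Contains-⊕⇔ : (α : Permutation′ 2) (τ : Permutation′ m) (π : Permutation′ n) →
              Contains π (α ⊕ τ) ⇔ ContainsWithin (Below τ π) π α
Contains-⊕⇔ α τ π = mk⇔
  (λ (g , occ) → let α-occ , τ-occ , α<τ = ⊕-occurrence⁻ α τ π occ in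
     _ , α-occ , _ , τ-occ , λ b → proj₁ (α<τ _ b) , proj₂ (α<τ _ b))
  (λ (e , α-occ , f , τ-occ , ne) → ⊕-occurrence⁺ α τ π α-occ τ-occ λ a b →
     ℕ.≤-<-trans (occurrence-right α π α-occ a) (proj₁ (ne b)) ,
     ℕ.≤-<-trans (occurrence-top α π α-occ a) (proj₂ (ne b)))

AvoidsWithin⇒Avoids : (α : Permutation′ 2) (τ : Permutation′ m) (π : Permutation′ n) →
                      ¬ ContainsWithin (Shape τ π) π α → Avoids π (α ⊕ τ)
AvoidsWithin⇒Avoids α τ π av c =
  let e , occ , b = to (Contains-⊕⇔ α τ π) c in av (e , occ , τ , inj₁ refl , b)

-- A box below an occurrence of the inverse of `τ` reflects to a box below an occurrence of `τ` in
-- `flip π`, which agrees with `π`.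
Avoids⇒AvoidsWithin : (α : Permutation′ 2) → flip α ≈ α → (τ : Permutation′ m) (π : Permutation′ n) →
                      IsInvolution π → Avoids π (α ⊕ τ) → ¬ ContainsWithin (Shape τ π) π α
Avoids⇒AvoidsWithin α _ τ π _ av (e , occ , _ , inj₁ refl , b) = av (from (Contains-⊕⇔ α τ π) (e , occ , b))
Avoids⇒AvoidsWithin α α⁻¹≈α τ π inv av (e , occ , _ , inj₂ refl , b) =
  let e′ , occ′ , b′ = ContainsWithin-flip {D = Below (flip τ) π} π α α⁻¹≈α (e , occ , b) in
  av (Contains-cong (α ⊕ τ) (flip π) π (involution-flip π inv)
       (from (Contains-⊕⇔ α τ (flip π)) (e′ , occ′ , Below-flip (flip τ) π b′)))

-- Patterns of length two as orders on values.

-- Taking `_⊏_` to be `_<_` or `_>_` gives 12 or 21, so that one argument serves both.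
record OrderPattern (α : Permutation′ 2) : Set₁ where
  field
    _⊏_         : Rel (Fin n) 0ℓ
    compare     : Trichotomous _≡_ (_⊏_ {n})
    wellFounded : WellFounded (_⊏_ {n})
    selfInverse : flip α ≈ α
    occurrence⇔ : (π : Permutation′ n) (e : Fin 2 → Fin n) →
                  IsOccurrence α π e ⇔ (e 0F < e 1F × (π ⟨$⟩ʳ e 0F) ⊏ (π ⟨$⟩ʳ e 1F))

  clean⇒avoids : {D : Cells n} → (∀ {i x y} → toℕ x ℕ.≤ toℕ y → D i y → D i x) → (π : Permutation′ n) →
                 (∀ c → CleanColumn _⊏_ D π c) → ¬ ContainsWithin D π α
  clean⇒avoids D-down π clean (e , occ , d) =
    let i<c , i⊏c = to (occurrence⇔ π e) occ
        below = λ a → D-down (occurrence-top α π occ a) d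
    in clean (e 1F) (e 0F) i<c i⊏c (below 0F) (below 1F)

  avoids⇒clean : {D : Cells n} (π : Permutation′ n) → ¬ ContainsWithin D π α → ∀ c → CleanColumn _⊏_ D π c
  avoids⇒clean {n = n} {D} π av c i i<c i⊏c di dc =
    -- The corner of the box lies in column `c` at the height of one of the two entries, so `di` or
    -- `dc` puts it in `D`.
    av (e , from (occurrence⇔ π e) (i<c , i⊏c) , in-D (α ⟨$⟩ˡ 1F))
    where
    e : Fin 2 → Fin n
    e 0F = i
    e 1F = c

    in-D : ∀ a → D c (π ⟨$⟩ʳ e a)
    in-D 0F = di
    in-D 1F = dc

open OrderPattern

-- Resorting an involution inside its shape.

resort : (β : Permutation′ 2) → OrderPattern β → (τ : Permutation′ m) (π : Permutation′ n) → IsInvolution π →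
         ∃[ ρ ] AgreeOff (Shape τ π) π ρ × IsInvolution ρ × Avoids ρ (β ⊕ τ)
-- `clean` concerns the shape of `π`; an occurrence inside the shape of `ρ` is brought there by
-- `Shape-⊇`.
resort β B τ π inv = ρ , π~ρ , ρ-inv , AvoidsWithin⇒Avoids β τ ρ λ (e , occ , s) →
  ρ-avoids (e , occ , Shape-⊇ τ π ρ π~ρ s)
  where
  D = Shape τ π
  sorted = clean-exists {_⊏_ = _⊏_ B} (tri⇒dec< (compare B)) (wellFounded B) (shape? τ π)
             (λ i<c → Shape-down τ π (ℕ.<⇒≤ i<c) ℕ.≤-refl) π
  ρ = proj₁ sorted
  π~ρ = proj₁ (proj₂ sorted)
  clean = proj₂ (proj₂ sorted)

  ρ-avoids : ¬ ContainsWithin D ρ β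
  ρ-avoids = clean⇒avoids B {D = D} (Shape-down τ π ℕ.≤-refl) ρ clean

  -- ρ⁻¹ is also a β-avoiding rearrangement of π = π⁻¹ inside D, so ρ⁻¹ = ρ.
  π~ρ⁻¹ : AgreeOff D π (flip ρ)
  π~ρ⁻¹ i = subst (λ x → x ≡ (ρ ⟨$⟩ˡ i) ⊎ D i x × D i (ρ ⟨$⟩ˡ i)) (involution-flip π inv i)
              (Sum.map₂ (λ (dπ , dρ) → Shape-sym τ π inv dπ , Shape-sym τ π inv dρ)
                (AgreeOff-flip {D = D} π ρ π~ρ i))

  ρ⁻¹-avoids : ¬ ContainsWithin D (flip ρ) β
  ρ⁻¹-avoids (e , occ , d) = ρ-avoids
    (ContainsWithin-flip {D = λ i x → D x i} (flip ρ) β (selfInverse B) (e , occ , Shape-sym τ π inv d))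

  ρ≈ρ⁻¹ : ρ ≈ flip ρ
  ρ≈ρ⁻¹ = clean-unique (compare B) {D} ρ (flip ρ)
    (AgreeOff-trans {D = D} ρ π (flip ρ) (AgreeOff-sym {D = D} π ρ π~ρ) π~ρ⁻¹)
    clean (avoids⇒clean B {D = D} (flip ρ) ρ⁻¹-avoids)

  ρ-inv : IsInvolution ρ
  ρ-inv i = trans (cong (ρ ⟨$⟩ʳ_) (ρ≈ρ⁻¹ i)) (inverseʳ ρ)

-- Both `π` and `π′` share the shape of their common image, so each is an `α`-avoiding rearrangement
-- of the other inside it, and uniqueness applies.
resort-injective : (α : Permutation′ 2) → OrderPattern α → (τ : Permutation′ m) (π π′ ρ ρ′ : Permutation′ n) →
                   IsInvolution π → Avoids π (α ⊕ τ) → AgreeOff (Shape τ π) π ρ →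
                   IsInvolution π′ → Avoids π′ (α ⊕ τ) → AgreeOff (Shape τ π′) π′ ρ′ →
                   ρ ≈ ρ′ → π ≈ π′
resort-injective α A τ π π′ ρ ρ′ inv av π~ρ inv′ av′ π′~ρ′ ρ≈ρ′ =
  clean-unique (compare A) {D} π π′ π~π′ (clean π inv av (λ s → s)) (clean π′ inv′ av′ D⊆D′)
  where
  D = Shape τ π

  ρ~ρ′ : (E : Cells _) → AgreeOff E ρ ρ′
  ρ~ρ′ _ i = inj₁ (ρ≈ρ′ i)

  D⊆D′ : ∀ {i x} → D i x → Shape τ π′ i x
  D⊆D′ s = Shape-⊇ τ π′ ρ′ π′~ρ′
    (Shape-⊆ τ ρ ρ′ (λ s → s) (ρ~ρ′ (Shape τ ρ)) (Shape-⊆ τ π ρ (λ s → s) π~ρ s))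

  D′⊆D : ∀ {i x} → Shape τ π′ i x → D i x
  D′⊆D s = Shape-⊇ τ π ρ π~ρ
    (Shape-⊇ τ ρ ρ′ (ρ~ρ′ (Shape τ ρ)) (Shape-⊆ τ π′ ρ′ (λ s → s) π′~ρ′ s))

  π~π′ : AgreeOff D π π′
  π~π′ = AgreeOff-trans {D = D} π ρ π′ π~ρ (AgreeOff-trans {D = D} ρ ρ′ π′ (ρ~ρ′ D)
           (AgreeOff-sym {D = D} π′ ρ′ (AgreeOff-mono {D = Shape τ π′} {E = D} D′⊆D π′ ρ′ π′~ρ′)))

  clean : ∀ χ → IsInvolution χ → Avoids χ (α ⊕ τ) → (∀ {i x} → D i x → Shape τ χ i x) →
          ∀ c → CleanColumn (_⊏_ A) D χ c
  clean χ inv av D⊆ = avoids⇒clean A {D = D} χ λ (e , occ , d) →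
    Avoids⇒AvoidsWithin α (selfInverse A) τ χ inv av (e , occ , D⊆ d)

-- Comparing the counts.

-- An injection between index sets bounds the length. The map is given as a relation because both
-- the image and its injectivity rest on proofs about the element.
length-≤ : {c ℓ r : Level} (S : Setoid c ℓ) → let open Setoid S renaming (Carrier to A; _≈_ to _≋_) in
           {xs ys : List A} (R : Rel A r) → Unique.Unique S xs →
           All (λ x → ∃[ y ] Membership._∈_ S y ys × R x y) xs →
           (∀ {x x′ y y′} → R x y → R x′ y′ → y ≋ y′ → x ≋ x′) →
           length xs ℕ.≤ length ys
length-≤ S {xs} {ys} R uniq images R-injective =
  injective⇒≤ {f = λ i → Any.index (∈-ys i)} λ {i} {i′} eq → lookup-injective uniq
    (R-injective (related i) (related i′) (Membershipₚ.index-injective S (∈-ys i) (∈-ys i′) eq))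
  where
  open Setoid S using () renaming (_≈_ to _≋_; sym to ≋-sym)

  image : ∀ i → ∃[ y ] Membership._∈_ S y ys × R (lookup xs i) y
  image i = All.lookup images (∈ₚ.∈-lookup {xs = xs} i)

  ∈-ys : ∀ i → Membership._∈_ S (proj₁ (image i)) ys
  ∈-ys i = proj₁ (proj₂ (image i))

  related : ∀ i → R (lookup xs i) (proj₁ (image i))
  related i = proj₂ (proj₂ (image i))

  lookup-injective : ∀ {zs} → Unique.Unique S zs → ∀ {i i′} → lookup zs i ≋ lookup zs i′ → i ≡ i′
  lookup-injective (_ ∷ _)   {zero}  {zero}   _  = refl
  lookup-injective (z≉ ∷ _)  {zero}  {suc i′} eq = contradiction eq (All.lookup z≉ (∈ₚ.∈-lookup i′))
  lookup-injective (z≉ ∷ _)  {suc i} {zero}   eq = contradiction (≋-sym eq) (All.lookup z≉ (∈ₚ.∈-lookup i))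
  lookup-injective (_ ∷ zs!) {suc i} {suc i′} eq = cong suc (lookup-injective zs! eq)

-- Resorting is injective up to pointwise equality. Applied in both directions this gives equal
-- counts, without composing the two maps.
ℐ-≤ : (α β : Permutation′ 2) → OrderPattern α → OrderPattern β → (τ : Permutation′ m) →
      ∀ n → ℐ n (α ⊕ τ) ℕ.≤ ℐ n (β ⊕ τ)
ℐ-≤ α β A B τ n = length-≤ S Resorts (Uniqueₚ.filter⁺ S (good? α) (permutations-unique n))
  (All.map (λ {π} → image {π}) (all-filter (good? α) (permutations n)))
  λ {π} {π′} {ρ} {ρ′} ((inv , av) , π~ρ) ((inv′ , av′) , π′~ρ′) →
    resort-injective α A τ π π′ ρ ρ′ inv av π~ρ inv′ av′ π′~ρ′
  where
  S = permutationSetoid n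

  Good : Permutation′ 2 → Permutation′ n → Set
  Good γ π = IsInvolution π × Avoids π (γ ⊕ τ)

  good? : ∀ γ π → Dec (Good γ π)
  good? γ π = involution? π ×-dec avoids? π (γ ⊕ τ)

  Good-resp : ∀ {π ρ} → π ≈ ρ → Good β π → Good β ρ
  Good-resp {π} {ρ} π≈ρ (inv , av) =
    (λ i → trans (cong (ρ ⟨$⟩ʳ_) (sym (π≈ρ i))) (trans (sym (π≈ρ _)) (inv i))) ,
    λ c → av (Contains-cong (β ⊕ τ) ρ π (λ i → sym (π≈ρ i)) c)

  Resorts : Permutation′ n → Permutation′ n → Set
  Resorts π ρ = Good α π × AgreeOff (Shape τ π) π ρ

  image : ∀ {π} → Good α π → ∃[ ρ ] Membership._∈_ S ρ (filter (good? β) (permutations n)) × Resorts π ρ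
  image {π} good@(inv , _) =
    let ρ , π~ρ , ρ-good = resort β B τ π inv in
    ρ ,
    Membershipₚ.∈-filter⁺ S (good? β) (λ {π} {ρ} → Good-resp {π} {ρ}) {v = ρ}
      (permutations-complete n ρ) ρ-good ,
    good , π~ρ

-- The patterns 12 and 21, and their exchange.

pair-monotone : (e : Fin 2 → Fin n) → e 0F < e 1F → Monotonic₁ _<_ _<_ e
pair-monotone e e< {0F} {1F} _ = e<
pair-monotone e e< {1F} {1F} (ℕ.s≤s ())

increasing : OrderPattern id
increasing = record
  { _⊏_         = _<_
  ; compare     = <-cmp
  ; wellFounded = <-wellFounded
  ; selfInverse = λ _ → refl
  ; occurrence⇔ = λ π e → mk⇔
      (λ (mono , iso) → mono (ℕ.s≤s ℕ.z≤n) , from (iso 0F 1F) (ℕ.s≤s ℕ.z≤n))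
      (λ (e< , π<) → (λ {a} {b} → pair-monotone e e< {a} {b}) , λ where
        0F 0F → mk⇔ (λ lt → contradiction lt (ℕ.<-irrefl refl)) (λ ())
        0F 1F → mk⇔ (λ _ → ℕ.s≤s ℕ.z≤n) (λ _ → π<)
        1F 0F → mk⇔ (λ lt → contradiction lt (ℕ.<-asym π<)) (λ ())
        1F 1F → mk⇔ (λ lt → contradiction lt (ℕ.<-irrefl refl)) (λ { (ℕ.s≤s ()) }))
  }

decreasing : OrderPattern (transpose 0F 1F)
decreasing = record
  { _⊏_         = _>_
  ; compare     = Flip.compare _ <-cmp
  ; wellFounded = >-wellFounded
  ; selfInverse = λ { 0F → refl ; 1F → refl }
  ; occurrence⇔ = λ π e → mk⇔
      (λ (mono , iso) → mono (ℕ.s≤s ℕ.z≤n) , from (iso 1F 0F) (ℕ.s≤s ℕ.z≤n))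
      (λ (e< , π>) → (λ {a} {b} → pair-monotone e e< {a} {b}) , λ where
        0F 0F → mk⇔ (λ lt → contradiction lt (ℕ.<-irrefl refl)) (λ { (ℕ.s≤s ()) })
        0F 1F → mk⇔ (λ lt → contradiction lt (ℕ.<-asym π>)) (λ ())
        1F 0F → mk⇔ (λ _ → ℕ.s≤s ℕ.z≤n) (λ _ → π>)
        1F 1F → mk⇔ (λ lt → contradiction lt (ℕ.<-irrefl refl)) (λ ()))
  }

corollary4p3 : Exchangeable (id {2}) (transpose 0F 1F)
corollary4p3 m τ n = ℕ.≤-antisym
  (ℐ-≤ id (transpose 0F 1F) increasing decreasing τ n)
  (ℐ-≤ (transpose 0F 1F) id decreasing increasing τ n)
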